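{- Let $\mathbf P=(P,\le,0,1)$ be a bounded poset satisfying the Descending Chain Condition, let $\mathbf Q=(Q,\le,0)$ be a poset with least element $0$, let $f$ be an up-homomorphism from $\mathbf P$ to $\mathbf Q$, and put $I:=[0](\ker f)=\{x\in P\mid f(x)=f(0)\}$. Then the following holds: (i) $I$ is an ideal of $\mathbf P$; (ii) if $\mathbf P$ satisfies the Ascending Chain Condition and $f^*\colon Q\to\mathbb A(\mathbf P)$ denotes the operator for which $(f,f^*)$ is a pair of operator-residuated mappings between $\mathbf P$ and $\mathbf Q$, then $|f^*(0)|=1$ and $I=[0,f^*(0)]$, where the singleton $f^*(0)$ is identified with its unique element.
   Context: For a poset $(P,\le)$ and $A\subseteq P$: $U(A)$ is the set of all upper bounds of $A$ in $P$, $U(x,y):=U(\{x,y\})$, and $\operatorname{Min}A$ is the set of all minimal elements of $A$. A mapping $f\colon P\to Q$ between posets is an up-homomorphism if $f\big(\operatorname{Min}U(x,y)\big)=\operatorname{Min}U\big(f(x),f(y)\big)$ (equality of subsets of $Q$, the left side being the image of a set under $f$) for all $x,y\in P$. A subset $I$ of $P$ is an ideal of $\mathbf P$ if for all $x,y\in I$ one has $\{z\in P\mid z\le x\}\subseteq I$ and $U(x,y)\cap I\ne\emptyset$. The Ascending (Descending) Chain Condition means that there are no infinite strictly ascending (descending) chains. A bounded poset is one with least element $0$ and greatest element $1$. $\mathbb A(\mathbf P)$ is the set of all non-empty antichains of $\mathbf P$. A pair of operator-residuated mappings between $\mathbf P$ and $\mathbf Q$ is a pair $(f,f^*)$ with $f\colon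 P\to Q$ and $f^*\colon Q\to\mathbb A(\mathbf P)$ such that for all $x\in P$, $y\in Q$: $f(x)\le y$ if and only if there is some $z\in f^*(y)$ with $x\le z$. Such an $f^*$ is uniquely determined by $f$. $[0,e]=\{x\in P\mid 0\le x\le e\}$. -}

module Defs where

open import Level using (Level; _⊔_; suc)
open import Data.Nat.Base using (ℕ)
open import Data.Product.Base using (∃; _×_)
open import Data.Sum.Base using (_⊎_)
open import Function.Base using (flip)
open import Function.Bundles using (Func; _⇔_)
open import Induction.InfiniteDescent using (InfiniteDescendingSequence)
open import Relation.Binary.Bundles using (Poset)
open import Relation.Binary.Definitions using (_Respects_)
open import Relation.Binary.Core using (Rel)
open import Relation.Nullary.Negation.Core using (¬_)
open import Relation.Unary using (Pred; _∈_; _⊆_; _∩_; _≐_; Satisfiable)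
import Relation.Binary.Construct.NonStrictToStrict as ToStrict

-- Posets carry a setoid equality _≈_; equality of elements always means _≈_,
-- and taking _≈_ to be _≡_ gives ordinary posets.

module _ {c ℓ₁ ℓ₂ : Level} (P : Poset c ℓ₁ ℓ₂) where
  open Poset P

  private
    _<_ : Rel Carrier (ℓ₁ ⊔ ℓ₂)
    _<_ = ToStrict._<_ _≈_ _≤_

  DCC : Set (c ⊔ ℓ₁ ⊔ ℓ₂)
  DCC = ¬ ∃ λ (s : ℕ → Carrier) → InfiniteDescendingSequence _<_ s

  ACC : Set (c ⊔ ℓ₁ ⊔ ℓ₂)
  ACC = ¬ ∃ λ (s : ℕ → Carrier) → InfiniteDescendingSequence (flip _<_) s

  UpperBounds : {a : Level} → Pred Carrier a → Pred Carrier (c ⊔ ℓ₂ ⊔ a)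
  UpperBounds A u = ∀ {x} → x ∈ A → x ≤ u

  Pair : Carrier → Carrier → Pred Carrier ℓ₁
  Pair x y z = z ≈ x ⊎ z ≈ y

  U : Carrier → Carrier → Pred Carrier (c ⊔ ℓ₁ ⊔ ℓ₂)
  U x y = UpperBounds (Pair x y)

  Min : {a : Level} → Pred Carrier a → Pred Carrier (c ⊔ ℓ₁ ⊔ ℓ₂ ⊔ a)
  Min A m = m ∈ A × (∀ {x} → x ∈ A → x ≤ m → x ≈ m)

  record IsIdeal {a : Level} (I : Pred Carrier a) : Set (c ⊔ ℓ₁ ⊔ ℓ₂ ⊔ a) where
    field
      downClosed : ∀ {x} → x ∈ I → (λ z → z ≤ x) ⊆ I
      directed   : ∀ {x y} → x ∈ I → y ∈ I → Satisfiable (U x y ∩ I)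

  Interval : Carrier → Carrier → Pred Carrier ℓ₂
  Interval a b x = a ≤ x × x ≤ b

  record NonEmptyAntichain (a : Level) : Set (c ⊔ ℓ₁ ⊔ ℓ₂ ⊔ suc a) where
    field
      members   : Pred Carrier a
      respects  : members Respects _≈_
      nonEmpty  : Satisfiable members
      antichain : ∀ {x y} → x ∈ members → y ∈ members → x ≤ y → x ≈ y

module _ {c ℓ₁ ℓ₂ d m₁ m₂ : Level} (P : Poset c ℓ₁ ℓ₂) (Q : Poset d m₁ m₂) where
  private
    module P = Poset P
    module Q = Poset Q

  Map : Set (c ⊔ ℓ₁ ⊔ d ⊔ m₁)
  Map = Func P.Eq.setoid Q.Eq.setoid

  Image : {a : Level} → Map → Pred P.Carrier a → Pred Q.Carrier (c ⊔ m₁ ⊔ a)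
  Image f A y = ∃ λ x → x ∈ A × Func.to f x Q.≈ y

  IsUpHomomorphism : Map → Set (c ⊔ ℓ₁ ⊔ ℓ₂ ⊔ d ⊔ m₁ ⊔ m₂)
  IsUpHomomorphism f =
    ∀ x y → Image f (Min P (U P x y)) ≐ Min Q (U Q (Func.to f x) (Func.to f y))

  Kernel : Map → Rel P.Carrier m₁
  Kernel f x y = Func.to f x Q.≈ Func.to f y

  KernelClass : Map → P.Carrier → Pred P.Carrier m₁
  KernelClass f a x = Kernel f x a

  -- f* need not be assumed to respect Q._≈_: the equivalence below forces
  -- f* y and f* y′ to have the same members whenever y ≈ y′.
  IsOperatorResiduated :
    {a : Level} → Map → (Q.Carrier → NonEmptyAntichain P a) → Set (c ⊔ ℓ₂ ⊔ d ⊔ m₂ ⊔ a)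
  IsOperatorResiduated f f* =
    ∀ x y → Func.to f x Q.≤ y ⇔ (∃ λ z → z ∈ NonEmptyAntichain.members (f* y) × x P.≤ z)

{-# OPTIONS --safe #-}
module Submission where

-- If x ≤ y then y is the only minimal upper bound of x and y, so an
-- up-homomorphism is monotone. If f x ≈ f y ≈ f 0, then f 0 is the minimal upper
-- bound of f x and f y, hence the image of a minimal upper bound of x and y: the
-- class of 0 is directed. Any two elements of f* 0 lie in this class, so they have
-- a common upper bound in it, which lies below an element of the antichain f* 0;
-- they both coincide with that element.

open import Defs
open import Level using (Level)
open import Data.Product using (Σ; ∃!; _×_; _,_; proj₁; proj₂)
open import Data.Sum using (inj₁; inj₂)
open import Function.Bundles using (Func; Equivalence)
open import Relation.Binary.Bundles using (Poset)
open import Relation.Binary.Definitions using (Minimum; Maximum)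
open import Relation.Unary using (_∈_; _≐_)

module _ {c ℓ₁ ℓ₂ : Level} (P : Poset c ℓ₁ ℓ₂) where
  open Poset P

  U-intro : ∀ {x y u} → x ≤ u → y ≤ u → u ∈ U P x y
  U-intro x≤u y≤u (inj₁ z≈x) = trans (reflexive z≈x) x≤u
  U-intro x≤u y≤u (inj₂ z≈y) = trans (reflexive z≈y) y≤u

  U-elimˡ : ∀ {x y u} → u ∈ U P x y → x ≤ u
  U-elimˡ u∈U = u∈U (inj₁ Eq.refl)

  U-elimʳ : ∀ {x y u} → u ∈ U P x y → y ≤ u
  U-elimʳ u∈U = u∈U (inj₂ Eq.refl)

  -- Any upper bound of the pair lies above `y`, so one below `y` coincides with it. Used in `P` for
  -- monotonicity and in `Q` for directedness.
  ≤⇒∈MinU : ∀ {x y} → x ≤ y → y ∈ Min P (U P x y)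
  ≤⇒∈MinU x≤y = U-intro x≤y refl , λ u∈U u≤y → antisym u≤y (U-elimʳ u∈U)

module _ {c ℓ₁ ℓ₂ d m₁ m₂ : Level} (P : Poset c ℓ₁ ℓ₂) (Q : Poset d m₁ m₂)
         (f : Map P Q) (up : IsUpHomomorphism P Q f) where
  private
    module P = Poset P
    module Q = Poset Q
  open Func f using (to)

  up-monotone : ∀ {x y} → x P.≤ y → to x Q.≤ to y
  up-monotone {x} {y} x≤y =
    -- The forward inclusion of `up` makes `to y` a minimal upper bound of `to x` and `to y`; only
    -- its being above `to x` matters here.
    U-elimˡ Q (proj₁ (proj₁ (up x y) (y , ≤⇒∈MinU P x≤y , Q.Eq.refl)))

  kernelClass-isIdeal : ∀ {b} → Minimum P._≤_ b → IsIdeal P (KernelClass P Q f b)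
  kernelClass-isIdeal {b} b-min = record
    { downClosed = λ fx≈fb z≤x →
        -- Monotonicity squeezes `to z` between `to b` and `to x`, which are equal.
        Q.antisym (Q.trans (up-monotone z≤x) (Q.reflexive fx≈fb))
                  (up-monotone (b-min _))
    ; directed = λ {x} {y} fx≈fb fy≈fb →
        let fx≈fy = Q.Eq.trans fx≈fb (Q.Eq.sym fy≈fb)
            -- The backward inclusion of `up` lifts `to y`, a minimal upper bound of the two equal
            -- images, to an upper bound `m` of `x` and `y`.
            m , m∈Min , fm≈fy = proj₂ (up x y) (≤⇒∈MinU Q (Q.reflexive fx≈fy))
        in m , proj₁ m∈Min , Q.Eq.trans fm≈fy fy≈fb
    }

  module _ {a : Level} (f* : Q.Carrier → NonEmptyAntichain P a)
           (residuated : IsOperatorResiduated P Q f f*)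
           {0P : P.Carrier} (0P-min : Minimum P._≤_ 0P)
           {0Q : Q.Carrier} (0Q-min : Minimum Q._≤_ 0Q) where
    open NonEmptyAntichain (f* 0Q)
    open IsIdeal (kernelClass-isIdeal 0P-min)

    member⇒kernelClass : ∀ {e} → e ∈ members → e ∈ KernelClass P Q f 0P
    member⇒kernelClass {e} e∈ = Q.antisym
      (Q.trans (Equivalence.from (residuated e 0Q) (e , e∈ , P.refl)) (0Q-min _))
      (up-monotone (0P-min e))

    -- Since `f* 0Q` has a member `e`, residuation and monotonicity give `to 0P ≤ to e ≤ 0Q`, so `f`
    -- sends least element to least element.
    kernelClass⇒≤0Q : ∀ {x} → x ∈ KernelClass P Q f 0P → to x Q.≤ 0Q
    kernelClass⇒≤0Q fx≈f0 =
      let e , e∈ = nonEmpty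
      in Q.trans (Q.reflexive fx≈f0)
           (Q.trans (up-monotone (0P-min e))
             (Equivalence.from (residuated e 0Q) (e , e∈ , P.refl)))

    members-unique : ∀ {e e′} → e ∈ members → e′ ∈ members → e P.≈ e′
    members-unique e∈ e′∈ =
      let u , u∈U , fu≈f0 = directed (member⇒kernelClass e∈) (member⇒kernelClass e′∈)
          z , z∈ , u≤z = Equivalence.to (residuated u 0Q) (kernelClass⇒≤0Q fu≈f0)
      in P.Eq.trans (antichain e∈ z∈ (P.trans (U-elimˡ P u∈U) u≤z))
           (P.Eq.sym (antichain e′∈ z∈ (P.trans (U-elimʳ P u∈U) u≤z)))

    -- Residuation puts each element of the class below some member, which can only be `e`;
    -- conversely `e` is in the class, which is closed downwards.
    kernelClass≐interval : ∀ {e} → e ∈ members →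
                           KernelClass P Q f 0P ≐ Interval P 0P e
    kernelClass≐interval e∈ =
      (λ {x} fx≈f0 →
        let z , z∈ , x≤z = Equivalence.to (residuated x 0Q) (kernelClass⇒≤0Q fx≈f0)
        in 0P-min x , P.trans x≤z (P.reflexive (members-unique z∈ e∈)))
      , λ (_ , x≤e) → downClosed (member⇒kernelClass e∈) x≤e

theorem4p3 :
    {c ℓ₁ ℓ₂ d m₁ m₂ a : Level}
    (P : Poset c ℓ₁ ℓ₂) (0P 1P : Poset.Carrier P) →
    Minimum (Poset._≤_ P) 0P → Maximum (Poset._≤_ P) 1P → DCC P →
    (Q : Poset d m₁ m₂) (0Q : Poset.Carrier Q) → Minimum (Poset._≤_ Q) 0Q →
    (f : Map P Q) → IsUpHomomorphism P Q f →
    IsIdeal P (KernelClass P Q f 0P)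
    × (ACC P →
       (f* : Poset.Carrier Q → NonEmptyAntichain P a) → IsOperatorResiduated P Q f f* →
       Σ (∃! (Poset._≈_ P) (NonEmptyAntichain.members (f* 0Q))) λ e →
         KernelClass P Q f 0P ≐ Interval P 0P (proj₁ e))
theorem4p3 P 0P 1P 0P-min _ _ Q 0Q 0Q-min f up =
  kernelClass-isIdeal P Q f up 0P-min ,
  λ _ f* residuated →
    let e , e∈ = NonEmptyAntichain.nonEmpty (f* 0Q)
    in (e , e∈ , members-unique P Q f up f* residuated 0P-min 0Q-min e∈)
       , kernelClass≐interval P Q f up f* residuated 0P-min 0Q-min e∈
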